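{- Let $n$ be an odd positive integer. There exists an ordering $w_0, w_1, \ldots, w_{2^n-3}$ of the set $\mathbb{Z}_2^n\setminus\{00\cdots0,\,11\cdots1\}$ in which every two consecutive words differ in exactly one bit position, and such that for every word $w$ in the set, the positions of $w$ and of its complement $\overline{w}$ in the ordering differ by exactly $2^{n-1}-1$.
   Context: For a binary word $w\in\mathbb{Z}_2^n$, its complement $\overline{w}$ is obtained by changing every $0$ to $1$ and every $1$ to $0$ (equivalently $\overline{w}=w+11\cdots1$). -}

module Defs where

open import Data.Bool.Base using (Bool; true; false; not)
open import Data.Fin.Base using (Fin; toℕ)
open import Data.Nat.Base using (ℕ; suc; _*_; ∣_-_∣)
open import Data.Product using (∃; ∃!; _×_)
open import Data.Vec.Base using (Vec; lookup; map; replicate)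
open import Function.Bundles using (_⇔_)
open import Function.Definitions using (Injective)
open import Relation.Binary.PropositionalEquality using (_≡_; _≢_)

Odd : ℕ → Set
Odd n = ∃ λ k → n ≡ suc (2 * k)

-- Elements of ℤ₂ⁿ, with false for 0 and true for 1.
Word : ℕ → Set
Word n = Vec Bool n

zeros ones : ∀ {n} → Word n
zeros = replicate _ false
ones  = replicate _ true

complement : ∀ {n} → Word n → Word n
complement = map not

DifferInOneBit : ∀ {n} → Word n → Word n → Set
DifferInOneBit u v = ∃! _≡_ λ i → lookup u i ≢ lookup v i

NonConstant : ∀ {n} → Word n → Set
NonConstant v = v ≢ zeros × v ≢ ones

-- The sequence w₀, …, w_{N-1} lists each word satisfying P exactly once,
-- and lists no other word.
record IsOrderingOf {n N} (P : Word n → Set) (w : Fin N → Word n) : Set where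
  field
    injective : Injective _≡_ _≡_ w
    range     : ∀ v → (∃ λ i → w i ≡ v) ⇔ P v

ConsecutiveDifferInOneBit : ∀ {n N} → (Fin N → Word n) → Set
ConsecutiveDifferInOneBit w =
  ∀ i j → toℕ j ≡ suc (toℕ i) → DifferInOneBit (w i) (w j)

ComplementsAtDistance : ∀ {n N} → ℕ → (Fin N → Word n) → Set
ComplementsAtDistance d w =
  ∀ i j → w j ≡ complement (w i) → ∣ toℕ i - toℕ j ∣ ≡ d

{-# OPTIONS --safe #-}

-- Write 0 for the zero word.  For odd k the cube ℤ₂ᵏ has a Hamiltonian path
-- 0, a, …, t with t of odd weight.  As a has odd weight and k is odd, ā has even weight, so
-- there is also a Hamiltonian path t, …, ā.  Hence 0a, …, 0t, 1t, …, 1ā is a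
-- path through ℤ₂ᵏ⁺¹ minus 0 from a word to its complement.  Prefixing it by 0
-- and continuing with the complements of its words gives the ordering of ℤ₂ᵏ⁺²:
-- at the junction, 01ā is followed by 11ā, the complement of 00a.
module Submission where

open import Defs
open import Data.Bool.Base using (Bool; true; false; not; _xor_)
open import Data.Bool.Properties
  using (_≟_; ¬-not; not-¬; not-injective; not-involutive)
open import Data.Fin.Base using (Fin; zero; suc; toℕ)
open import Data.Fin.Properties using (toℕ-injective)
open import Data.List.Base as List using (List; []; _∷_; _++_; length)
open import Data.List.Membership.Propositional using (_∈_)
open import Data.List.Membership.Propositional.Properties
  using (∈-lookup; ∈-map⁺; ∈-map⁻; ∈-++⁺ˡ; ∈-++⁺ʳ)
open import Data.List.Properties using (length-++; length-map; map-++; map-∘)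
open import Data.List.Relation.Binary.Permutation.Propositional
  using (_↭_; ↭-refl; ↭-sym; ↭-trans; prep; ↭⇒↭ₛ; module PermutationReasoning)
open import Data.List.Relation.Binary.Permutation.Propositional.Properties
  using (∈-resp-↭; map⁺; ++⁺; ++-comm; shift; ↭-length)
import Data.List.Relation.Binary.Permutation.Setoid.Properties as Permutationₛ
open import Data.List.Relation.Binary.Disjoint.Propositional using (Disjoint)
open import Data.List.Relation.Unary.All as All using ([]; _∷_)
open import Data.List.Relation.Unary.AllPairs using ([]; _∷_)
open import Data.List.Relation.Unary.Any using (here; there; index)
open import Data.List.Relation.Unary.Any.Properties using (lookup-index)
open import Data.List.Relation.Unary.Unique.Propositional using (Unique)
import Data.List.Relation.Unary.Unique.Propositional.Properties as Unique
open import Data.Nat.Base using (ℕ; zero; suc; _+_; _*_; _∸_; _^_; ∣_-_∣)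
open import Data.Nat.Properties
  using (+-identityʳ; +-suc; *-suc; ∣m-m+n∣≡n; ∣-∣-comm; +-comm)
open import Data.Product using (∃; ∃₂; _×_; _,_)
open import Data.Sum.Base using (_⊎_; inj₁; inj₂)
open import Data.Vec.Base as Vec using ([]; _∷_)
open import Data.Vec.Properties using (∷-injectiveʳ)
open import Function.Base using (_∘_)
open import Function.Bundles using (mk⇔)
open import Relation.Binary.PropositionalEquality
open import Relation.Nullary.Decidable using (yes; no)
open import Relation.Nullary.Negation using (contradiction)

-- Positions of entries in lists.

module _ {A : Set} where

  infix 4 _[_]=_

  -- Positions are plain numbers rather than elements of `Fin`, so that those in a concatenation are
  -- obtained by addition, without casts.
  data _[_]=_ : List A → ℕ → A → Set where
    here  : ∀ {x xs} → x ∷ xs [ zero ]= x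
    there : ∀ {x y xs p} → xs [ p ]= x → y ∷ xs [ suc p ]= x

  lookup⇒[]= : ∀ xs i → xs [ toℕ i ]= List.lookup xs i
  lookup⇒[]= (x ∷ xs) zero    = here
  lookup⇒[]= (x ∷ xs) (suc i) = there (lookup⇒[]= xs i)

  []=⇒∈ : ∀ {x xs p} → xs [ p ]= x → x ∈ xs
  []=⇒∈ here      = here refl
  []=⇒∈ (there q) = there ([]=⇒∈ q)

  []=-++ˡ : ∀ {x xs ys p} → xs [ p ]= x → xs ++ ys [ p ]= x
  []=-++ˡ here      = here
  []=-++ˡ (there q) = there ([]=-++ˡ q)

  []=-++ʳ : ∀ xs {x ys p} → ys [ p ]= x → xs ++ ys [ length xs + p ]= x
  []=-++ʳ []       q = q
  []=-++ʳ (_ ∷ xs) q = there ([]=-++ʳ xs q)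

  []=-++⁻ : ∀ xs {x ys p} → xs ++ ys [ p ]= x →
            xs [ p ]= x ⊎ ∃ λ q → p ≡ length xs + q × ys [ q ]= x
  []=-++⁻ []       q    = inj₂ (_ , refl , q)
  []=-++⁻ (_ ∷ xs) here = inj₁ here
  []=-++⁻ (_ ∷ xs) (there q) with []=-++⁻ xs q
  ... | inj₁ r              = inj₁ (there r)
  ... | inj₂ (_ , refl , r) = inj₂ (_ , refl , r)

  []=-unique : ∀ {x xs p q} → Unique xs → xs [ p ]= x → xs [ q ]= x → p ≡ q
  []=-unique _         here      here      = refl
  []=-unique (x∉ ∷ _)  here      (there r) = contradiction refl (All.lookup x∉ ([]=⇒∈ r))
  []=-unique (x∉ ∷ _)  (there q) here      = contradiction refl (All.lookup x∉ ([]=⇒∈ q))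
  []=-unique (_ ∷ xs!) (there q) (there r) = cong suc ([]=-unique xs! q r)

  lookup-injective : ∀ {xs : List A} → Unique xs →
                     ∀ {i j} → List.lookup xs i ≡ List.lookup xs j → i ≡ j
  lookup-injective {xs} xs! {i} {j} eq = toℕ-injective
    ([]=-unique xs! (lookup⇒[]= xs i) (subst (xs [ toℕ j ]=_) (sym eq) (lookup⇒[]= xs j)))

  Unique-resp-↭ : ∀ {xs ys : List A} → xs ↭ ys → Unique xs → Unique ys
  Unique-resp-↭ σ = Permutationₛ.Unique-resp-↭ (setoid A) (↭⇒↭ₛ σ)

module _ {A B : Set} (f : A → B) where

  []=-map : ∀ {x xs p} → xs [ p ]= x → List.map f xs [ p ]= f x
  []=-map here      = here
  []=-map (there q) = there ([]=-map q)

  []=-map⁻ : ∀ xs {y p} → List.map f xs [ p ]= y → ∃ λ x → y ≡ f x × xs [ p ]= x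
  []=-map⁻ (x ∷ xs) here = x , refl , here
  []=-map⁻ (_ ∷ xs) (there q) with []=-map⁻ xs q
  ... | x , eq , r = x , eq , there r

-- Paths in a graph, indexed by their ends and their list of vertices.

data Path {A : Set} (R : A → A → Set) : A → A → List A → Set where
  [_] : ∀ x → Path R x x (x ∷ [])
  _∷_ : ∀ {x y z xs} → R x y → Path R y z xs → Path R x z (x ∷ xs)

module _ {A : Set} {R : A → A → Set} where

  join : ∀ {x y y′ z xs ys} → Path R x y xs → R y y′ → Path R y′ z ys →
         Path R x z (xs ++ ys)
  join [ _ ]   s q = s ∷ q
  join (r ∷ p) s q = r ∷ join p s q

  consecutive : ∀ {x z xs a b p} → Path R x z xs →
                xs [ p ]= a → xs [ suc p ]= b → R a b
  consecutive (r ∷ [ _ ])   here      (there here) = r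
  consecutive (r ∷ (_ ∷ _)) here      (there here) = r
  consecutive (_ ∷ π)       (there q) (there q′)   = consecutive π q q′

mapPath : ∀ {A B : Set} {R : A → A → Set} {S : B → B → Set} (f : A → B) →
          (∀ {x y} → R x y → S (f x) (f y)) →
          ∀ {x z xs} → Path R x z xs → Path S (f x) (f z) (List.map f xs)
mapPath f g [ x ]   = [ f x ]
mapPath f g (r ∷ p) = g r ∷ mapPath f g p

-- Adjacency, complementation and parity of words.

data Adjacent : ∀ {n} → Word n → Word n → Set where
  flip : ∀ {n} b (v : Word n) → Adjacent (b ∷ v) (not b ∷ v)
  keep : ∀ {n} b {u v : Word n} → Adjacent u v → Adjacent (b ∷ u) (b ∷ v)

-- `Adjacent` is a recursive form of `DifferInOneBit`, which lets facts about complements and parity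
-- be proved by induction on the adjacency.
Adjacent⇒DifferInOneBit : ∀ {n} {u v : Word n} → Adjacent u v → DifferInOneBit u v
Adjacent⇒DifferInOneBit (flip b v) = zero , not-¬ refl , unique
  where
  unique : ∀ {i} → Vec.lookup (b ∷ v) i ≢ Vec.lookup (not b ∷ v) i → zero ≡ i
  unique {zero}  _  = refl
  unique {suc i} ne = contradiction refl ne
Adjacent⇒DifferInOneBit (keep b {u} {v} a) with Adjacent⇒DifferInOneBit a
... | i , differ , only = suc i , differ , unique
  where
  unique : ∀ {j} → Vec.lookup (b ∷ u) j ≢ Vec.lookup (b ∷ v) j → suc i ≡ j
  unique {zero}  ne = contradiction refl ne
  unique {suc j} ne = cong suc (only ne)

complement-Adjacent : ∀ {n} {u v : Word n} →
                      Adjacent u v → Adjacent (complement u) (complement v)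
complement-Adjacent (flip b v) = flip (not b) (complement v)
complement-Adjacent (keep b a) = keep (not b) (complement-Adjacent a)

complement-involutive : ∀ {n} (v : Word n) → complement (complement v) ≡ v
complement-involutive []      = refl
complement-involutive (b ∷ v) = cong₂ _∷_ (not-involutive b) (complement-involutive v)

complement-zeros : ∀ n → complement (zeros {n}) ≡ ones
complement-zeros zero    = refl
complement-zeros (suc n) = cong (true ∷_) (complement-zeros n)

parity : ∀ {n} → Word n → Bool
parity []      = false
parity (b ∷ v) = b xor parity v

Adjacent⇒parity : ∀ {n} {u v : Word n} → Adjacent u v → parity v ≡ not (parity u)
Adjacent⇒parity (flip false v) = refl
Adjacent⇒parity (flip true v)  = sym (not-involutive _)
Adjacent⇒parity (keep false a) = Adjacent⇒parity a
Adjacent⇒parity (keep true a)  = cong not (Adjacent⇒parity a)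

parity-tail-same : ∀ b {p q} → b xor q ≡ not (b xor p) → q ≡ not p
parity-tail-same false eq = eq
parity-tail-same true  eq = not-injective eq

parity-tail-flip : ∀ b {p q} → not b xor q ≡ not (b xor p) → q ≡ p
parity-tail-flip false eq = not-injective eq
parity-tail-flip true  eq = trans eq (not-involutive _)

-- Bits are taken in pairs: complementing both bits of a pair leaves their sum modulo 2 unchanged.
parity-complement-even : ∀ m (v : Word (2 * m)) → parity (complement v) ≡ parity v
parity-complement-even zero [] = refl
parity-complement-even (suc m) v rewrite +-suc m (m + 0) with v
... | false ∷ false ∷ u = trans (not-involutive _) (parity-complement-even m u)
... | false ∷ true  ∷ u = cong not (parity-complement-even m u)
... | true  ∷ false ∷ u = cong not (parity-complement-even m u)
... | true  ∷ true  ∷ u =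
  trans (parity-complement-even m u) (sym (not-involutive _))

parity-complement-odd : ∀ m (v : Word (suc (2 * m))) →
                        parity (complement v) ≡ not (parity v)
parity-complement-odd m (false ∷ v) = cong not (parity-complement-even m v)
parity-complement-odd m (true ∷ v)  =
  trans (parity-complement-even m v) (sym (not-involutive _))

-- Enumeration of all words of a given length.

words : ∀ n → List (Word n)
words zero    = [] ∷ []
words (suc n) = List.map (false ∷_) (words n) ++ List.map (true ∷_) (words n)

words-complete : ∀ {n} (v : Word n) → v ∈ words n
words-complete []          = here refl
words-complete (false ∷ v) = ∈-++⁺ˡ (∈-map⁺ (false ∷_) (words-complete v))
words-complete (true ∷ v)  = ∈-++⁺ʳ _ (∈-map⁺ (true ∷_) (words-complete v))

words-unique : ∀ n → Unique (words n)
words-unique zero    = [] ∷ []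
words-unique (suc n) = Unique.++⁺
  (Unique.map⁺ ∷-injectiveʳ (words-unique n))
  (Unique.map⁺ ∷-injectiveʳ (words-unique n))
  disjoint
  where
  disjoint : Disjoint (List.map (false ∷_) (words n)) (List.map (true ∷_) (words n))
  disjoint (p , q) with ∈-map⁻ (false ∷_) p | ∈-map⁻ (true ∷_) q
  ... | _ , _ , refl | _ , _ , ()

words-length : ∀ n → length (words n) ≡ 2 ^ n
words-length zero    = refl
words-length (suc n) = begin
  length (words (suc n))
    ≡⟨ length-++ (List.map (false ∷_) (words n)) ⟩
  length (List.map (false ∷_) (words n)) + length (List.map (true ∷_) (words n))
    ≡⟨ cong₂ _+_ (length-map _ (words n)) (length-map _ (words n)) ⟩
  length (words n) + length (words n)
    ≡⟨ cong₂ _+_ (words-length n) (trans (words-length n) (sym (+-identityʳ _))) ⟩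
  2 ^ suc n ∎
  where open ≡-Reasoning

-- This allows the half with first bit `b` to be listed first for either value of `b`, which spares
-- the path constructions a case distinction.
words-by-head : ∀ n b →
  List.map (b ∷_) (words n) ++ List.map (not b ∷_) (words n) ↭ words (suc n)
words-by-head n false = ↭-refl
words-by-head n true  = ++-comm (List.map (true ∷_) (words n)) _

-- Hamiltonian paths in the cube.

Hamiltonian : ∀ {n} → Word n → Word n → Set
Hamiltonian {n} u v = ∃ λ xs → Path Adjacent u v xs × xs ↭ words n

-- This is Hamiltonian laceability of the cube, bipartite with respect to `parity`. Both ends are
-- left free because the induction on the dimension chooses them anew.
Laceable : ℕ → Set
Laceable n = ∀ (u v : Word n) → parity v ≡ not (parity u) → Hamiltonian u v

-- One half is traversed completely, then the other. The crossing is at a neighbour of `u`, whose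
-- parity is opposite to that of `u` and hence to that of `v`.
hamiltonian-across : ∀ {n} → Laceable n → ∀ b (u v : Word n) → parity v ≡ parity u →
                     Hamiltonian (b ∷ u) (not b ∷ v)
hamiltonian-across _   b []      []   _    = _ , flip b [] ∷ [ _ ] , words-by-head 0 b
hamiltonian-across lac b (d ∷ u) v same
  with flipped ← Adjacent⇒parity (flip d u)
  with xs , π , σ ← lac (d ∷ u) (not d ∷ u) flipped
  with ys , ρ , τ ← lac (not d ∷ u) v
    (trans same (trans (sym (not-involutive _)) (cong not (sym flipped))))
  = _
  , join (mapPath (b ∷_) (keep b) π) (flip b _) (mapPath (not b ∷_) (keep (not b)) ρ)
  , ↭-trans (++⁺ (map⁺ _ σ) (map⁺ _ τ)) (words-by-head _ b)

-- The whole other half is inserted after the first vertex of a Hamiltonian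
-- path of the half containing both ends.
hamiltonian-within : ∀ {n} → Laceable n → ∀ b (u v : Word n) → parity v ≡ not (parity u) →
                     Hamiltonian (b ∷ u) (b ∷ v)
hamiltonian-within {n} lac b u v odd with lac u v odd
-- A path of one vertex would make `u` and `v` equal, against their parities.
... | _ , [ _ ] , _ = contradiction odd (not-¬ refl)
... | _ , _∷_ {y = w} {xs = xs} a π , σ
  with ys , ρ , τ ← lac u w (Adjacent⇒parity a)
  = _
  , flip b u ∷ join (mapPath (not b ∷_) (keep (not b)) ρ) back (mapPath (b ∷_) (keep b) π)
  , (begin
      (b ∷ u) ∷ List.map (not b ∷_) ys ++ List.map (b ∷_) xs
        ↭⟨ shift (b ∷ u) (List.map (not b ∷_) ys) _ ⟨
      List.map (not b ∷_) ys ++ List.map (b ∷_) (u ∷ xs)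
        ↭⟨ ++-comm (List.map (not b ∷_) ys) _ ⟩
      List.map (b ∷_) (u ∷ xs) ++ List.map (not b ∷_) ys
        ↭⟨ ++⁺ (map⁺ _ σ) (map⁺ _ τ) ⟩
      List.map (b ∷_) (words n) ++ List.map (not b ∷_) (words n)
        ↭⟨ words-by-head n b ⟩
      words (suc n) ∎)
  where
  open PermutationReasoning
  back : Adjacent (not b ∷ w) (b ∷ w)
  back = subst (λ c → Adjacent (not b ∷ w) (c ∷ w)) (not-involutive b) (flip (not b) w)

-- Induction on the dimension. If the first bits agree, the tails have opposite parity; otherwise
-- they have equal parity, as the respective construction requires.
laceable : ∀ n → Laceable n
laceable zero    []      []      ()
laceable (suc n) (b ∷ u) (c ∷ v) odd with c ≟ b
... | yes refl = hamiltonian-within (laceable n) b u v (parity-tail-same b odd)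
... | no c≢b with refl ← ¬-not c≢b =
  hamiltonian-across (laceable n) b u v (parity-tail-flip b odd)

-- The cube without its zero word.

Punctured : ℕ → Set
Punctured n = ∃₂ λ (u : Word n) xs →
  Path Adjacent u (complement u) xs × zeros ∷ xs ↭ words n

punctured : ∀ m → Punctured (suc (suc (2 * m)))
punctured m
  -- The two words share all bits after the first, so `refl` shows that their parities are opposite
  -- without evaluating either.
  with laceable (suc (2 * m)) zeros (true ∷ zeros) refl
... | _ , _∷_ {y = a} r π , σ
  -- `a` has the parity of `true ∷ zeros`, and complementation in odd dimension reverses it.
  with _ , ρ , τ ← laceable (suc (2 * m)) (true ∷ zeros) (complement a)
    (trans (parity-complement-odd m a) (cong not (Adjacent⇒parity r)))
  = false ∷ a , _
  , join (mapPath (false ∷_) (keep false) π) (flip false _) (mapPath (true ∷_) (keep true) ρ)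
  , ++⁺ (map⁺ _ σ) (map⁺ _ τ)

-- Continuing a list with the complements of its words.

map-complement-∷ : ∀ {n} b (xs : List (Word n)) →
  List.map complement (List.map (b ∷_) xs) ≡ List.map (not b ∷_) (List.map complement xs)
map-complement-∷ b xs = trans (sym (map-∘ xs)) (map-∘ xs)

words-complement : ∀ n → List.map complement (words n) ↭ words n
words-complement zero    = ↭-refl
words-complement (suc n)
  rewrite map-++ complement (List.map (false ∷_) (words n)) (List.map (true ∷_) (words n))
        | map-complement-∷ false (words n) | map-complement-∷ true (words n)
  = ↭-trans (++⁺ (map⁺ _ (words-complement n)) (map⁺ _ (words-complement n)))
            (words-by-head n true)

doubled : ∀ {n} → List (Word (suc n)) → List (Word (suc n))
doubled xs = xs ++ List.map complement xs

-- Together with `zeros`, the prefixed words fill the half with first bit `false`, so their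
-- complements fill the other half. The complement of `zeros` is `ones`, which only has to be moved
-- to the front.
doubled-words : ∀ {n} (xs : List (Word n)) → zeros ∷ xs ↭ words n →
                zeros ∷ ones ∷ doubled (List.map (false ∷_) xs) ↭ words (suc n)
doubled-words {n} xs σ = begin
  zeros ∷ ones ∷ doubled ys
    ↭⟨ prep zeros (shift ones ys _) ⟨
  (zeros ∷ ys) ++ ones ∷ List.map complement ys
    ≡⟨ cong (λ v → (zeros ∷ ys) ++ v ∷ List.map complement ys) (complement-zeros (suc n)) ⟨
  (zeros ∷ ys) ++ List.map complement (zeros ∷ ys)
    ≡⟨ cong ((zeros ∷ ys) ++_) (map-complement-∷ false (zeros ∷ xs)) ⟩
  List.map (false ∷_) (zeros ∷ xs) ++ List.map (true ∷_) (List.map complement (zeros ∷ xs))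
    ↭⟨ ++⁺ (map⁺ _ σ) (map⁺ _ (↭-trans (map⁺ complement σ) (words-complement n))) ⟩
  words (suc n) ∎
  where
  open PermutationReasoning
  ys = List.map (false ∷_) xs

-- From lists of words to orderings.

words↭-complete : ∀ {n} {xs : List (Word n)} → xs ↭ words n → ∀ v → v ∈ xs
words↭-complete σ v = ∈-resp-↭ (↭-sym σ) (words-complete v)

words↭-unique : ∀ {n} {xs : List (Word n)} → xs ↭ words n → Unique xs
words↭-unique σ = Unique-resp-↭ (↭-sym σ) (words-unique _)

words↭-length : ∀ {n} {xs : List (Word n)} → xs ↭ words n → length xs ≡ 2 ^ n
words↭-length {n} σ = trans (↭-length σ) (words-length n)

lookup-isOrdering : ∀ {n} {xs : List (Word n)} → zeros ∷ ones ∷ xs ↭ words n →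
                    IsOrderingOf NonConstant (List.lookup xs)
lookup-isOrdering {xs = xs} σ with words↭-unique σ
... | (_ ∷ zeros∉) ∷ ones∉ ∷ xs! = record
  { injective = lookup-injective xs!
  ; range     = λ v → mk⇔ nonConstant (listed (words↭-complete σ v))
  }
  where
  nonConstant : ∀ {v} → (∃ λ i → List.lookup xs i ≡ v) → NonConstant v
  nonConstant (i , refl) =
    All.lookup zeros∉ (∈-lookup i) ∘ sym , All.lookup ones∉ (∈-lookup i) ∘ sym

  listed : ∀ {v} → v ∈ zeros ∷ ones ∷ xs → NonConstant v → ∃ λ i → List.lookup xs i ≡ v
  listed (here eq)         (≢zeros , _) = contradiction eq ≢zeros
  listed (there (here eq)) (_ , ≢ones)  = contradiction eq ≢ones
  listed (there (there p)) _            = index p , sym (lookup-index p)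

lookup-consecutive : ∀ {n} {u v : Word n} {xs} → Path Adjacent u v xs →
                     ConsecutiveDifferInOneBit (List.lookup xs)
lookup-consecutive {xs = xs} π i j eq = Adjacent⇒DifferInOneBit
  (consecutive π (lookup⇒[]= xs i) (subst (xs [_]= List.lookup xs j) eq (lookup⇒[]= xs j)))

-- The complement of an entry of the first half occurs `length xs` places later, that of an entry of
-- the second half as many places earlier. As the entries are distinct, `j` must be that position.
doubled-distance : ∀ {n} (xs : List (Word (suc n))) → Unique (doubled xs) →
                   ComplementsAtDistance (length xs) (List.lookup (doubled xs))
doubled-distance xs xs! i j eq = go ([]=-++⁻ xs (lookup⇒[]= (doubled xs) i))
  where
  N = length xs
  at : ∀ {p v} → doubled xs [ p ]= v → v ≡ complement (List.lookup (doubled xs) i) → toℕ j ≡ p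
  at q refl = []=-unique xs!
    (subst (doubled xs [ toℕ j ]=_) eq (lookup⇒[]= (doubled xs) j)) q

  ∣m-n+m∣≡n : ∀ m n → ∣ m - n + m ∣ ≡ n
  ∣m-n+m∣≡n m n = trans (cong (∣ m -_∣) (+-comm n m)) (∣m-m+n∣≡n m n)

  go : xs [ toℕ i ]= List.lookup (doubled xs) i ⊎
       (∃ λ q → toℕ i ≡ N + q × List.map complement xs [ q ]= List.lookup (doubled xs) i) →
       ∣ toℕ i - toℕ j ∣ ≡ N
  go (inj₁ q)
    rewrite at ([]=-++ʳ xs ([]=-map complement q)) refl
    = ∣m-n+m∣≡n (toℕ i) N
  go (inj₂ (p , eqᵢ , q))
    with x , eqₓ , r ← []=-map⁻ complement xs q
    rewrite at ([]=-++ˡ r) (sym (trans (cong complement eqₓ) (complement-involutive x))) | eqᵢ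
    = trans (∣-∣-comm (N + p) p) (∣m-n+m∣≡n p N)

-- The number of words and the distance are parameters, so that list lengths can be replaced by
-- expressions in powers of two.
Conclusion : ℕ → ℕ → ℕ → Set
Conclusion n N d = ∃ λ (w : Fin N → Word n) →
  IsOrderingOf NonConstant w × ConsecutiveDifferInOneBit w × ComplementsAtDistance d w

-- The condition on consecutive words is assumed directly instead of through a `Path`, since a
-- `Path` is never empty and the ordering for dimension one is.
ordering : ∀ {n} (xs : List (Word n)) → zeros ∷ xs ↭ words n →
           ConsecutiveDifferInOneBit (List.lookup (doubled (List.map (false ∷_) xs))) →
           Conclusion (suc n) (2 ^ suc n ∸ 2) (2 ^ n ∸ 1)
ordering {n} xs σ steps = subst₂ (Conclusion (suc n))
  -- The full lists also count `zeros` and `ones` here, and only `zeros` in the half; the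
  -- subtractions remove these.
  (cong (_∸ 2) (words↭-length (doubled-words xs σ)))
  (trans (length-map (false ∷_) xs) (cong (_∸ 1) (words↭-length σ)))
  ( List.lookup (doubled (List.map (false ∷_) xs))
  , lookup-isOrdering (doubled-words xs σ)
  , steps
  , doubled-distance (List.map (false ∷_) xs) doubled-unique
  )
  where
  doubled-unique : Unique (doubled (List.map (false ∷_) xs))
  doubled-unique with words↭-unique (doubled-words xs σ)
  ... | _ ∷ _ ∷ xs! = xs!

punctured⇒ordering : ∀ {n} → Punctured n → Conclusion (suc n) (2 ^ suc n ∸ 2) (2 ^ n ∸ 1)
punctured⇒ordering (u , xs , π , σ) = ordering xs σ (lookup-consecutive
  -- `true ∷ complement u` is by computation the complement of `false ∷ u`, where the second half
  -- starts.
  (join half (flip false (complement u)) (mapPath complement complement-Adjacent half)))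
  where
  half = mapPath (false ∷_) (keep false) π

theorem1 : (n : ℕ) → Odd n →
    ∃ λ (w : Fin (2 ^ n ∸ 2) → Word n) →
    IsOrderingOf NonConstant w
    × ConsecutiveDifferInOneBit w
    × ComplementsAtDistance (2 ^ (n ∸ 1) ∸ 1) w
-- In dimension one both words are constant, so the ordering is empty.
theorem1 _ (zero , refl) = ordering [] ↭-refl (λ ())
theorem1 _ (suc m , refl) =
  -- The punctured cube has dimension one less than the theorem's, namely `2 * suc m`, which is
  -- rewritten from `2 + 2 * m`.
  punctured⇒ordering (subst Punctured (sym (*-suc 2 m)) (punctured m))
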